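{- Suppose that $(\Gamma,\alpha)$ is an abstract 1-skeleton of type $(k,n)$ such that $\alpha$ is $l$-independent, where $l\le k$. Then for faces $F^{m_1},\dots,F^{m_s}$ of dimension less than $l$ in $(\Gamma,\alpha)$ with $s>1$, their intersection $F^{m_1}\cap\cdots\cap F^{m_s}$ is either empty or the disjoint union of lower-dimensional faces.
   Context: Let $G=(\mathbb{Z}_2)^k$, $k\ge1$. $\mathrm{Hom}(G,\mathbb{Z}_2)$ is regarded as a $k$-dimensional vector space over $\mathbb{Z}_2$ with zero element $\rho_0$. An abstract 1-skeleton of type $(k,n)$ (with $n\ge k$) is a pair $(\Gamma,\alpha)$ where $\Gamma$ is a finite $n$-valent regular graph without loops, with vertex set $V_\Gamma$ and edge set $E_\Gamma$, and $\alpha:E_\Gamma\to\mathrm{Hom}(G,\mathbb{Z}_2)\setminus\{\rho_0\}$ is a map such that, with $E_p$ the set of edges adjacent to the vertex $p$ and $\alpha(E_p)$ the collection of values of $\alpha$ on $E_p$ (counted with multiplicity): (1) for each $p\in V_\Gamma$, $\alpha(E_p)$ spans $\mathrm{Hom}(G,\mathbb{Z}_2)$; (2) for each edge $e$ with endpoints $p,q$, $\alpha(E_p)\equiv\alpha(E_q)\bmod\alpha(e)$. $\alpha$ is $l$-independent if for each vertex $p\in V_\Gamma$ any $l$ elements of $\alpha(E_p)$ are linearly independent in $\mathrm{Hom}(G,\mathbb{Z}_2)$. For $0\le\ell\le n$, an $\ell$-dimensional face ($\ell$-face) of $(\Gamma,\alpha)$ is a pair $(\Gamma',\alpha|_{\Gamma'})$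 with $\Gamma'$ a connected $\ell$-valent subgraph of $\Gamma$ for which there is a subspace $K$ of $\mathrm{Hom}(G,\mathbb{Z}_2)$ such that (writing $E_p|_{\Gamma'}$ for the edges of $\Gamma'$ adjacent to $p$) (1) for each vertex $p\in V_{\Gamma'}$, $\alpha(E_p|_{\Gamma'})$ spans $K$, and (2) for each edge $e=pq$ of $\Gamma'$, $\alpha(E_p|_{\Gamma'})\equiv\alpha(E_q|_{\Gamma'})\bmod\alpha(e)$. Each vertex of $\Gamma$ is a $0$-face. $F^{m_i}$ denotes a face of dimension $m_i$. Intersections of faces are intersections of subgraphs.
   Formalization: "Lower-dimensional" is read as: each component has dimension at most every m_i, and strictly less than m_i unless F^{m_i} is contained in all the other faces (then the intersection is F^{m_i} itself, so the literal claim fails). -}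

module Defs where

open import Level using (0ℓ)
open import Algebra.Bundles using (AbelianGroup; CommutativeRing)
open import Algebra.Bundles.Raw using (RawGroup)
open import Algebra.Definitions.RawMonoid using (sum)
open import Algebra.Morphism.Bundles using (GroupHomomorphism)
open import Algebra.Morphism.Structures using (IsGroupMonomorphism)
import Algebra.Construct.Pointwise as Pointwise
import Algebra.Properties.CommutativeSemigroup as CommutativeSemigroupProperties
import Algebra.Morphism.GroupMonomorphism as GroupMonomorphism
open import Data.Bool.Base using (Bool; true; false; _xor_)
open import Data.Bool.Properties using (xor-∧-commutativeRing; xor-assoc; xor-identityʳ; xor-same)
open import Data.Fin.Base using (Fin)
import Data.Fin.Properties as Fin
open import Data.Fin.Subset using (Subset; _∈_; _⊆_; _∩_; ⊤; Nonempty; Empty)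
open import Data.Fin.Subset.Properties using (_∈?_; ∈⊤; x∈p∩q⁺; x∈p∩q⁻)
open import Data.List.Base using (List; map; filter; length; lookup; allFin)
import Data.List.Relation.Binary.Permutation.Setoid as Permutation
import Data.List.Relation.Binary.Sublist.Propositional as Sublist
open import Data.Nat.Base using (ℕ; _≤_; _<_)
open import Data.Product.Base using (Σ-syntax; ∃-syntax; _×_; _,_; proj₁; proj₂)
open import Data.Sum.Base using (_⊎_)
import Data.Vec.Functional as Vector
open import Function.Base using (_∘_)
open import Function.Bundles using (_⇔_)
open import Relation.Binary.Bundles using (Setoid)
open import Relation.Binary.Construct.Closure.ReflexiveTransitive using (Star)
open import Relation.Binary.PropositionalEquality
  using (_≡_; _≢_; refl; sym; trans; cong; cong₂)
open import Relation.Nullary using (¬_; Dec)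
open import Relation.Nullary.Decidable using (_⊎-dec_)

-- Addition in ℤ₂ is xor on Bool.
ℤ₂ : AbelianGroup 0ℓ 0ℓ
ℤ₂ = CommutativeRing.+-abelianGroup xor-∧-commutativeRing

-- (ℤ₂)ᵏ, as functions Fin k → Bool up to pointwise equality.
ℤ₂^ : ℕ → AbelianGroup 0ℓ 0ℓ
ℤ₂^ k = Pointwise.abelianGroup (Fin k) ℤ₂

Hom : ℕ → Set
Hom k = GroupHomomorphism (AbelianGroup.rawGroup (ℤ₂^ k)) (AbelianGroup.rawGroup ℤ₂)

module _ {k : ℕ} where

  open GroupHomomorphism

  private
    module ℤ₂-Properties = CommutativeSemigroupProperties (AbelianGroup.commutativeSemigroup ℤ₂)
    module Fun = AbelianGroup (Pointwise.abelianGroup (AbelianGroup.Carrier (ℤ₂^ k)) ℤ₂)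

  infix 4 _≈_
  infixl 6 _+_
  infixr 7 _•_

  _≈_ : Hom k → Hom k → Set
  ρ ≈ σ = ∀ g → ⟦ ρ ⟧ g ≡ ⟦ σ ⟧ g

  ρ₀ : Hom k
  ⟦ ρ₀ ⟧ _ = false
  isGroupHomomorphism ρ₀ = record
    { isMonoidHomomorphism = record
      { isMagmaHomomorphism = record
        { isRelHomomorphism = record { cong = λ _ → refl }
        ; homo = λ _ _ → refl
        }
      ; ε-homo = refl
      }
    ; ⁻¹-homo = λ _ → refl
    }

  _+_ : Hom k → Hom k → Hom k
  ⟦ ρ + σ ⟧ g = ⟦ ρ ⟧ g xor ⟦ σ ⟧ g
  isGroupHomomorphism (ρ + σ) = record
    { isMonoidHomomorphism = record
      { isMagmaHomomorphism = record
        { isRelHomomorphism = record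
          { cong = λ g≈h → cong₂ _xor_ (⟦⟧-cong ρ g≈h) (⟦⟧-cong σ g≈h) }
        ; homo = λ g h → trans (cong₂ _xor_ (homo ρ g h) (homo σ g h))
                               (ℤ₂-Properties.interchange (⟦ ρ ⟧ g) (⟦ ρ ⟧ h) (⟦ σ ⟧ g) (⟦ σ ⟧ h))
        }
      ; ε-homo = cong₂ _xor_ (ε-homo ρ) (ε-homo σ)
      }
    ; ⁻¹-homo = λ g → cong₂ _xor_ (⁻¹-homo ρ g) (⁻¹-homo σ g)
    }

  -- Every element is its own negative.
  Hom-rawGroup : RawGroup 0ℓ 0ℓ
  Hom-rawGroup = record
    { Carrier = Hom k ; _≈_ = _≈_ ; _∙_ = _+_ ; ε = ρ₀ ; _⁻¹ = λ ρ → ρ }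

  private
    ⟦⟧-isGroupMonomorphism : IsGroupMonomorphism Hom-rawGroup Fun.rawGroup ⟦_⟧
    ⟦⟧-isGroupMonomorphism = record
      { isGroupHomomorphism = record
        { isMonoidHomomorphism = record
          { isMagmaHomomorphism = record
            { isRelHomomorphism = record { cong = λ ρ≈σ → ρ≈σ }
            ; homo = λ _ _ _ → refl
            }
          ; ε-homo = λ _ → refl
          }
        ; ⁻¹-homo = λ _ _ → refl
        }
      ; injective = λ ρ≈σ → ρ≈σ
      }

  Hom-abelianGroup : AbelianGroup 0ℓ 0ℓ
  Hom-abelianGroup = record
    { isAbelianGroup =
        GroupMonomorphism.isAbelianGroup ⟦⟧-isGroupMonomorphism Fun.isAbelianGroup }

  _•_ : Bool → Hom k → Hom k
  true  • ρ = ρ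
  false • ρ = ρ₀

  linearCombination : (ρs : List (Hom k)) → (Fin (length ρs) → Bool) → Hom k
  linearCombination ρs c =
    sum (AbelianGroup.rawMonoid Hom-abelianGroup) (λ i → c i • lookup ρs i)

  LinearlyIndependent : List (Hom k) → Set
  LinearlyIndependent ρs = ∀ c → linearCombination ρs c ≈ ρ₀ → ∀ i → c i ≡ false

  record Subspace : Set₁ where
    field
      Member : Hom k → Set
      resp   : ∀ {ρ σ} → ρ ≈ σ → Member ρ → Member σ
      ρ₀-mem : Member ρ₀
      +-mem  : ∀ {ρ σ} → Member ρ → Member σ → Member (ρ + σ)
      •-mem  : ∀ c {ρ} → Member ρ → Member (c • ρ)

  InSpan : List (Hom k) → Hom k → Set
  InSpan ρs ρ = ∃[ c ] ρ ≈ linearCombination ρs c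

  _Spans_ : List (Hom k) → Subspace → Set
  ρs Spans K = ∀ ρ → InSpan ρs ρ ⇔ Subspace.Member K ρ

  _SpansHom : List (Hom k) → Set
  ρs SpansHom = ∀ ρ → InSpan ρs ρ

  -- The quotient of Hom k by the line spanned by τ.
  modulo : Hom k → Setoid 0ℓ 0ℓ
  modulo τ = record
    { Carrier = Hom k
    ; _≈_ = λ ρ σ → ∃[ c ] ρ ≈ σ + c • τ
    ; isEquivalence = record
      { refl  = λ {ρ} → false , λ g → sym (xor-identityʳ (⟦ ρ ⟧ g))
      ; sym   = λ {ρ} {σ} → λ (c , p) → c , λ g → flip-over (⟦ ρ ⟧ g) (⟦ σ ⟧ g) _ (p g)
      ; trans = λ {ρ} {σ} {π} → λ (c , p) (d , q) → d xor c , λ g →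
          trans (p g) (trans (cong (_xor ⟦ c • τ ⟧ g) (q g))
            (trans (xor-assoc (⟦ π ⟧ g) _ _) (cong (⟦ π ⟧ g xor_) (add-scalars d c g))))
      }
    }
    where
    flip-over : ∀ a b c → a ≡ b xor c → b ≡ a xor c
    flip-over _ b c refl =
      sym (trans (xor-assoc b c c) (trans (cong (b xor_) (xor-same c)) (xor-identityʳ b)))

    add-scalars : ∀ d c g → ⟦ d • τ ⟧ g xor ⟦ c • τ ⟧ g ≡ ⟦ (d xor c) • τ ⟧ g
    add-scalars false c g = refl
    add-scalars true false g = xor-identityʳ _
    add-scalars true true g = xor-same (⟦ τ ⟧ g)

  -- Equality of multisets of residues modulo τ.
  _≡_mod_ : List (Hom k) → List (Hom k) → Hom k → Set
  ρs ≡ σs mod τ = Permutation._↭_ (modulo τ) ρs σs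

-- Undirected, with multiple edges allowed.  The order of the two endpoints
-- carries no information: nothing below depends on it.
record Graph : Set where
  field
    #V #E    : ℕ
    end₁     : Fin #E → Fin #V
    end₂     : Fin #E → Fin #V
    loopless : ∀ e → end₁ e ≢ end₂ e

  _IncidentTo_ : Fin #E → Fin #V → Set
  e IncidentTo p = end₁ e ≡ p ⊎ end₂ e ≡ p

  incidentTo? : ∀ p e → Dec (e IncidentTo p)
  incidentTo? p e = (end₁ e Fin.≟ p) ⊎-dec (end₂ e Fin.≟ p)

  edgesAt : Fin #V → List (Fin #E)
  edgesAt p = filter (incidentTo? p) (allFin #E)

  Regular : ℕ → Set
  Regular n = ∀ p → length (edgesAt p) ≡ n

module _ (Γ : Graph) where

  open Graph Γ

  record Subgraph : Set where
    field
      vertices : Subset #V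
      edges    : Subset #E
      closed   : ∀ {e} → e ∈ edges → end₁ e ∈ vertices × end₂ e ∈ vertices

module _ {Γ : Graph} where

  open Graph Γ
  open Subgraph

  edgesAtIn : Subgraph Γ → Fin #V → List (Fin #E)
  edgesAtIn Δ p = filter (_∈? edges Δ) (edgesAt p)

  RegularSubgraph : ℕ → Subgraph Γ → Set
  RegularSubgraph d Δ = ∀ p → p ∈ vertices Δ → length (edgesAtIn Δ p) ≡ d

  Adjacent : Subgraph Γ → Fin #V → Fin #V → Set
  Adjacent Δ p q = ∃[ e ] e ∈ edges Δ ×
    ((end₁ e ≡ p × end₂ e ≡ q) ⊎ (end₁ e ≡ q × end₂ e ≡ p))

  Connected : Subgraph Γ → Set
  Connected Δ = Nonempty (vertices Δ) ×
    (∀ {p q} → p ∈ vertices Δ → q ∈ vertices Δ → Star (Adjacent Δ) p q)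

  -- A subgraph without vertices has no edges, by `closed`.
  IsEmpty : Subgraph Γ → Set
  IsEmpty Δ = Empty (vertices Δ)

  infix 4 _⊑_
  _⊑_ : Subgraph Γ → Subgraph Γ → Set
  Δ ⊑ Δ′ = vertices Δ ⊆ vertices Δ′ × edges Δ ⊆ edges Δ′

  infixr 7 _⊓_
  _⊓_ : Subgraph Γ → Subgraph Γ → Subgraph Γ
  vertices (Δ ⊓ Δ′) = vertices Δ ∩ vertices Δ′
  edges    (Δ ⊓ Δ′) = edges Δ ∩ edges Δ′
  closed   (Δ ⊓ Δ′) e∈ with x∈p∩q⁻ (edges Δ) (edges Δ′) e∈
  ... | e∈Δ , e∈Δ′ = x∈p∩q⁺ (proj₁ (closed Δ e∈Δ) , proj₁ (closed Δ′ e∈Δ′))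
                   , x∈p∩q⁺ (proj₂ (closed Δ e∈Δ) , proj₂ (closed Δ′ e∈Δ′))

  whole : Subgraph Γ
  whole = record { vertices = ⊤ ; edges = ⊤ ; closed = λ _ → ∈⊤ , ∈⊤ }

  intersection : ∀ {s} → (Fin s → Subgraph Γ) → Subgraph Γ
  intersection = Vector.foldr _⊓_ whole

  -- Vertex-disjoint subgraphs are automatically edge-disjoint.
  record IsDisjointUnion {t} (Δ : Subgraph Γ) (C : Fin t → Subgraph Γ) : Set where
    field
      vertices-union : ∀ p → p ∈ vertices Δ ⇔ (∃[ j ] p ∈ vertices (C j))
      edges-union    : ∀ e → e ∈ edges Δ ⇔ (∃[ j ] e ∈ edges (C j))
      disjoint       : ∀ {i j} → i ≢ j → IsEmpty (C i ⊓ C j)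

record AbstractOneSkeleton (k n : ℕ) : Set where
  field
    Γ         : Graph
  open Graph Γ public
  field
    regular   : Regular n
    α         : Fin #E → Hom k
    α-nonzero : ∀ e → ¬ (α e ≈ ρ₀)
    spanning  : ∀ p → map α (edgesAt p) SpansHom
    congruent : ∀ e → map α (edgesAt (end₁ e)) ≡ map α (edgesAt (end₂ e)) mod α e

module _ {k n : ℕ} (S : AbstractOneSkeleton k n) where

  open AbstractOneSkeleton S
  open Subgraph

  -- A sublist of `edgesAt p` is a choice of distinct edges at p, so equal
  -- labels on different edges count as different elements of α(E_p).
  Independent : ℕ → Set
  Independent l = ∀ p es → es Sublist.⊆ edgesAt p → length es ≡ l →
    LinearlyIndependent (map α es)

  -- The second component of a face, the restriction of α, is determined by
  -- the subgraph.
  record IsFace (d : ℕ) (Δ : Subgraph Γ) : Set₁ where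
    field
      dim≤n     : d ≤ n
      connected : Connected Δ
      regular   : RegularSubgraph d Δ
      K         : Subspace {k}
      spanning  : ∀ p → p ∈ vertices Δ → map α (edgesAtIn Δ p) Spans K
      congruent : ∀ e → e ∈ edges Δ →
        map α (edgesAtIn Δ (end₁ e)) ≡ map α (edgesAtIn Δ (end₂ e)) mod α e

  -- "Of lower dimension than the faces F i, of dimensions m i": d never
  -- exceeds m i and is strictly below it, except that equality has to be
  -- allowed when F i lies in all the other faces, since the intersection is
  -- then F i itself.  If the faces are not all equal, some F i is not of this
  -- exceptional kind.
  LowerDimension : ∀ {s} (m : Fin s → ℕ) (F : Fin s → Subgraph Γ) → ℕ → Set
  LowerDimension m F d =
    ∀ i → d ≤ m i × (¬ (∀ j → F i ⊑ F j) → d < m i)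

  IsDisjointUnionOfLowerFaces : ∀ {s} (m : Fin s → ℕ) (F : Fin s → Subgraph Γ) →
    Subgraph Γ → Set₁
  IsDisjointUnionOfLowerFaces m F Δ =
    ∃[ t ] Σ[ d ∈ (Fin t → ℕ) ] Σ[ C ∈ (Fin t → Subgraph Γ) ]
      IsDisjointUnion Δ C ×
      (∀ j → IsFace (d j) (C j) × LowerDimension m F (d j))

{-# OPTIONS --safe #-}

-- Let F be a face of dimension < l, and let p be a vertex of F with edges e, f ∈ F and g ∈ Γ.
-- The edges of F at p together with g are at most l, so by l-independence
-- α(f) ≡ α(g) mod α(e) forces f = g.  So for an edge e = pq lying in all the faces, an edge of
-- the intersection at p is matched by the congruences of the different faces with one and the
-- same edge at q.  The intersection therefore satisfies the congruence along e; hence the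
-- number of its edges at a vertex and their span are constant along its edges, and its
-- connected components are faces.  A component of dimension mᵢ contains, by connectedness
-- of Fᵢ, all of Fᵢ.

module Submission where

open import Defs
open import Algebra.Bundles using (AbelianGroup)
open import Algebra.Morphism.Bundles using (GroupHomomorphism)
import Algebra.Properties.CommutativeMonoid.Sum as Sum
open import Data.Bool.Base using (Bool; true; false; _xor_; _∧_; if_then_else_)
open import Data.Bool.Properties using (xor-identityʳ; xor-same)
open import Data.Fin.Base using (Fin; zero; suc)
import Data.Fin.Properties as Fin
open import Data.Fin.Subset using (Subset; _∈_)
open import Data.Fin.Subset.Properties using (_∈?_; ∈⊤; x∈p∩q⁺; x∈p∩q⁻)
open import Data.List.Base using (List; []; _∷_; _++_; map; filter; length; lookup; allFin)
open import Data.List.Membership.Propositional using (find; lose) renaming (_∈_ to _∈ₗ_)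
open import Data.List.Membership.Propositional.Properties
  using (∈-map⁺; ∈-map⁻; ∈-filter⁺; ∈-filter⁻; ∈-allFin; ∈-lookup)
import Data.List.Membership.Setoid as SetoidMembership
import Data.List.Membership.Setoid.Properties as SetoidMembershipₚ
open import Data.List.Properties using (length-map)
import Data.List.Relation.Binary.Permutation.Setoid as Permutation
import Data.List.Relation.Binary.Permutation.Setoid.Properties as Permutationₚ
open import Data.List.Relation.Binary.Pointwise using (Pointwise-≡⇒≡)
import Data.List.Relation.Binary.Sublist.Propositional as Sublist
open Sublist using ([]; _∷_; _∷ʳ_; ⊆-refl) renaming (_⊆_ to _⊆ₗ_)
import Data.List.Relation.Binary.Sublist.Propositional.Properties as Sublistₚ
import Data.List.Relation.Unary.All as All
import Data.List.Relation.Unary.All.Properties as Allₚ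
open import Data.List.Relation.Unary.AllPairs using ([]; _∷_)
open import Data.List.Relation.Unary.Any using (here; there; index)
import Data.List.Relation.Unary.Any.Properties as Anyₚ
open import Data.List.Relation.Unary.Unique.Propositional using (Unique)
open import Data.List.Relation.Unary.Unique.Propositional.Properties using (allFin⁺; filter⁺)
import Data.List.Relation.Unary.Unique.Setoid as UniqueSetoid
import Data.List.Relation.Unary.Unique.Setoid.Properties as UniqueSetoidₚ
open import Data.Nat.Base using (ℕ; zero; suc; _≤_; _<_; s≤s; s≤s⁻¹)
open import Data.Nat.Properties using (≤-refl; ≤-trans; n≤1+n; m≤n⇒m<n∨m≡n)
open import Data.Product.Base using (∃-syntax; _×_; _,_; proj₁; proj₂)
open import Data.Sum.Base using (_⊎_; inj₁; inj₂; [_,_]′; swap)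
open import Data.Vec.Base using (tabulate)
open import Data.Vec.Properties using ([]=⇒lookup; lookup⇒[]=; lookup∘tabulate)
open import Function.Base using (_∘_; id)
open import Function.Bundles using (mk⇔)
open import Relation.Binary.Bundles using (Setoid)
open import Relation.Binary.Construct.Closure.ReflexiveTransitive
  using (Star; ε; _◅_; _◅◅_; reverse)
open import Relation.Binary.PropositionalEquality
  using (_≡_; refl; sym; trans; cong; cong₂; subst; subst₂)
open import Relation.Nullary using (¬_; yes; no; does)
open import Relation.Nullary.Decidable using (dec-true; dec-false; _×-dec_)
open import Relation.Nullary.Negation using (contradiction)
open import Relation.Unary using (Pred; Decidable)

-- Linear combinations, spans and independence over ℤ₂.

module _ {k : ℕ} where

  open GroupHomomorphism using (⟦_⟧)
  open AbelianGroup (Hom-abelianGroup {k}) using (commutativeMonoid)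
  open Sum commutativeMonoid using (sum-cong-≋; sum-replicate-zero; ∑-distrib-+)

  •-distrib-xor : ∀ a b (ρ : Hom k) → (a xor b) • ρ ≈ a • ρ + b • ρ
  •-distrib-xor false b     ρ g = refl
  •-distrib-xor true  false ρ g = sym (xor-identityʳ _)
  •-distrib-xor true  true  ρ g = sym (xor-same (⟦ ρ ⟧ g))

  linearCombination-xor : ∀ (ρs : List (Hom k)) c d →
    linearCombination ρs (λ i → c i xor d i) ≈
    linearCombination ρs c + linearCombination ρs d
  linearCombination-xor ρs c d g = trans
    (sum-cong-≋ {x = λ i → (c i xor d i) • lookup ρs i}
                (λ i → •-distrib-xor (c i) (d i) (lookup ρs i)) g)
    (∑-distrib-+ (λ i → c i • lookup ρs i) (λ i → d i • lookup ρs i) g)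

  linearCombination-∧ : ∀ (ρs : List (Hom k)) b c →
    linearCombination ρs (λ i → b ∧ c i) ≈ b • linearCombination ρs c
  linearCombination-∧ ρs true  c g = refl
  linearCombination-∧ ρs false c g = sum-replicate-zero (length ρs) g

  -- As a family of coefficients, this is the standard basis vector at i.
  indicator : ∀ {n} → Fin n → Fin n → Bool
  indicator i j = does (i Fin.≟ j)

  linearCombination-indicator : ∀ (ρs : List (Hom k)) i →
    linearCombination ρs (indicator i) ≈ lookup ρs i
  linearCombination-indicator (ρ ∷ ρs) zero    g = trans
    (cong (⟦ ρ ⟧ g xor_) (sum-replicate-zero (length ρs) g))
    (xor-identityʳ _)
  linearCombination-indicator (ρ ∷ ρs) (suc i) g = linearCombination-indicator ρs i g

  span : List (Hom k) → Subspace
  span ρs = record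
    { Member = InSpan ρs
    ; resp   = λ ρ≈σ (c , p) → c , λ g → trans (sym (ρ≈σ g)) (p g)
    ; ρ₀-mem = (λ _ → false) , λ g → sym (sum-replicate-zero (length ρs) g)
    ; +-mem  = λ (c , p) (d , q) → (λ i → c i xor d i) , λ g →
        trans (cong₂ _xor_ (p g) (q g)) (sym (linearCombination-xor ρs c d g))
    ; •-mem  = scale
    }
    where
    scale : ∀ b {ρ} → InSpan ρs ρ → InSpan ρs (b • ρ)
    scale true  ρ∈ = ρ∈
    scale false _  = (λ _ → false) , λ g → sym (sum-replicate-zero (length ρs) g)

  ∈⇒InSpan : ∀ {ρs : List (Hom k)} {ρ} → ρ ∈ₗ ρs → InSpan ρs ρ
  ∈⇒InSpan {ρs} {ρ} ρ∈ = indicator (index ρ∈) , λ g → trans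
    (cong (λ σ → ⟦ σ ⟧ g) (Anyₚ.lookup-index ρ∈))
    (sym (linearCombination-indicator ρs (index ρ∈) g))

  module _ (K : Subspace {k}) where

    open Subspace K

    linearCombination-mem : ∀ {ρs} → (∀ {ρ} → ρ ∈ₗ ρs → Member ρ) →
      ∀ c → Member (linearCombination ρs c)
    linearCombination-mem {[]}     _  c = ρ₀-mem
    linearCombination-mem {ρ ∷ ρs} ρs∈ c = resp
      {c zero • ρ + linearCombination ρs (c ∘ suc)} {linearCombination (ρ ∷ ρs) c} (λ _ → refl)
      (+-mem {c zero • ρ} {linearCombination ρs (c ∘ suc)}
        (•-mem (c zero) (ρs∈ (here refl)))
        (linearCombination-mem (ρs∈ ∘ there) (c ∘ suc)))

    span-least : ∀ {ρs} → (∀ {ρ} → ρ ∈ₗ ρs → Member ρ) → ∀ {ρ} → InSpan ρs ρ → Member ρ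
    span-least ρs∈ (c , p) = resp (λ g → sym (p g)) (linearCombination-mem ρs∈ c)

  -- The coefficients form the relation eᵢ + eⱼ + b eₕ; if i ≠ j, those at i and j can only
  -- vanish when h = i and h = j.
  separates-residues : ∀ {ρs : List (Hom k)} → LinearlyIndependent ρs → ∀ {i j h} b →
    lookup ρs i ≈ lookup ρs j + b • lookup ρs h → i ≡ j
  separates-residues {ρs} independent {i} {j} {h} b p with i Fin.≟ j
  ... | yes i≡j = i≡j
  ... | no  i≢j = trans (sym h≡i) h≡j
    where
    c d : Fin (length ρs) → Bool
    d x = indicator j x xor (b ∧ indicator h x)
    c x = indicator i x xor d x

    d-value : linearCombination ρs d ≈ lookup ρs j + b • lookup ρs h
    d-value g = trans
      (linearCombination-xor ρs (indicator j) (λ x → b ∧ indicator h x) g)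
      (cong₂ _xor_ (linearCombination-indicator ρs j g)
        (trans (linearCombination-∧ ρs b (indicator h) g) (scaled b)))
      where
      scaled : ∀ b → ⟦ b • linearCombination ρs (indicator h) ⟧ g ≡ ⟦ b • lookup ρs h ⟧ g
      scaled true  = linearCombination-indicator ρs h g
      scaled false = refl

    relation : linearCombination ρs c ≈ ρ₀
    relation g = trans (linearCombination-xor ρs (indicator i) d g)
      (trans (cong₂ _xor_ (trans (linearCombination-indicator ρs i g) (p g)) (d-value g))
             (xor-same (⟦ lookup ρs j + b • lookup ρs h ⟧ g)))

    hits : ∀ {x} b → true xor (b ∧ indicator h x) ≡ false → h ≡ x
    hits {x} true q with h Fin.≟ x
    ... | yes h≡x = h≡x

    h≡i : h ≡ i
    h≡i = hits b (trans
      (cong₂ (λ u v → u xor (v xor (b ∧ indicator h i)))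
        (sym (dec-true (i Fin.≟ i) refl)) (sym (dec-false (j Fin.≟ i) (i≢j ∘ sym))))
      (independent c relation i))

    h≡j : h ≡ j
    h≡j = hits b (trans
      (cong₂ (λ u v → u xor (v xor (b ∧ indicator h j)))
        (sym (dec-false (i Fin.≟ j) i≢j)) (sym (dec-true (j Fin.≟ j) refl)))
      (independent c relation j))

-- Sublists, filters and lists without repetition.

module _ {a} {A : Set a} where

  -- Serves to adjoin an arbitrary edge of Γ at a vertex to the edges of a face there. If the
  -- element has been chosen already, the length does not grow, hence the inequality.
  insert-sublist : ∀ {xs ys : List A} {y} → xs ⊆ₗ ys → y ∈ₗ ys →
    ∃[ zs ] xs ⊆ₗ zs × zs ⊆ₗ ys × y ∈ₗ zs × length zs ≤ suc (length xs)
  insert-sublist {xs} (y ∷ʳ xs⊆ys) (here refl) =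
    y ∷ xs , y ∷ʳ ⊆-refl , refl ∷ xs⊆ys , here refl , ≤-refl
  insert-sublist (z ∷ʳ xs⊆ys) (there y∈) with insert-sublist xs⊆ys y∈
  ... | zs , xs⊆zs , zs⊆ys , y∈zs , len = zs , xs⊆zs , z ∷ʳ zs⊆ys , y∈zs , len
  insert-sublist {x ∷ xs} (refl ∷ xs⊆ys) (here refl) =
    x ∷ xs , ⊆-refl , refl ∷ xs⊆ys , here refl , n≤1+n _
  insert-sublist {x ∷ xs} (refl ∷ xs⊆ys) (there y∈) with insert-sublist xs⊆ys y∈
  ... | zs , xs⊆zs , zs⊆ys , y∈zs , len =
    x ∷ zs , refl ∷ xs⊆zs , refl ∷ zs⊆ys , there y∈zs , s≤s len

  -- `Independent` speaks of exactly l edges, so a shorter choice of edges has to be enlarged to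
  -- that length before it applies.
  pad-sublist : ∀ {xs ys : List A} {n} → xs ⊆ₗ ys → length xs ≤ n → n ≤ length ys →
    ∃[ zs ] xs ⊆ₗ zs × zs ⊆ₗ ys × length zs ≡ n
  pad-sublist {n = zero} [] _ _ = [] , [] , [] , refl
  pad-sublist {ys = y ∷ ys} (y ∷ʳ xs⊆ys) xs≤n n≤ys with m≤n⇒m<n∨m≡n n≤ys
  ... | inj₂ refl = y ∷ ys , y ∷ʳ xs⊆ys , ⊆-refl , refl
  -- There are still n elements after y, so y can be left out.
  ... | inj₁ n<ys with pad-sublist xs⊆ys xs≤n (s≤s⁻¹ n<ys)
  ...   | zs , xs⊆zs , zs⊆ys , len = zs , xs⊆zs , y ∷ʳ zs⊆ys , len
  pad-sublist {x ∷ xs} (refl ∷ xs⊆ys) (s≤s xs≤n) (s≤s n≤ys) with pad-sublist xs⊆ys xs≤n n≤ys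
  ... | zs , xs⊆zs , zs⊆ys , len = x ∷ zs , refl ∷ xs⊆zs , refl ∷ zs⊆ys , cong suc len

  filter-cong-∈ : ∀ {p q} {P : Pred A p} {Q : Pred A q} (P? : Decidable P) (Q? : Decidable Q) xs →
    (∀ {x} → x ∈ₗ xs → P x → Q x) → (∀ {x} → x ∈ₗ xs → Q x → P x) →
    filter P? xs ≡ filter Q? xs
  filter-cong-∈ P? Q? []       P⇒Q Q⇒P = refl
  filter-cong-∈ P? Q? (x ∷ xs) P⇒Q Q⇒P
    with P? x | Q? x | filter-cong-∈ P? Q? xs (P⇒Q ∘ there) (Q⇒P ∘ there)
  ... | yes _ | yes _ | eq = cong (x ∷_) eq
  ... | no  _ | no  _ | eq = eq
  ... | yes p | no ¬q | _  = contradiction (P⇒Q (here refl) p) ¬q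
  ... | no ¬p | yes q | _  = contradiction (Q⇒P (here refl) q) ¬p

  -- A position in `map f xs` comes from a single position in `xs`, so equal positions identify the
  -- elements even where `f` repeats a value. For labels, this keeps different edges with equal
  -- labels apart.
  index-map⁺-injective : ∀ {b} {B : Set b} (f : A → B) {x y xs} (x∈ : x ∈ₗ xs) (y∈ : y ∈ₗ xs) →
    index (∈-map⁺ f x∈) ≡ index (∈-map⁺ f y∈) → x ≡ y
  index-map⁺-injective f (here refl) (here refl) _  = refl
  index-map⁺-injective f (there x∈)  (there y∈)  eq =
    index-map⁺-injective f x∈ y∈ (Fin.suc-injective eq)

  unique-map⁺-∈ : ∀ {b ℓ} (S : Setoid b ℓ) (f : A → Setoid.Carrier S) {xs} →
    (∀ {x y} → x ∈ₗ xs → y ∈ₗ xs → Setoid._≈_ S (f x) (f y) → x ≡ y) →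
    Unique xs → UniqueSetoid.Unique S (map f xs)
  unique-map⁺-∈ S f inj []            = []
  unique-map⁺-∈ S f inj (x∉xs ∷ uniq) =
    Allₚ.map⁺ (All.tabulate λ y∈ fx≈fy → All.lookup x∉xs y∈ (inj (here refl) (there y∈) fx≈fy))
    ∷ unique-map⁺-∈ S f (λ x∈ y∈ → inj (there x∈) (there y∈)) uniq

-- Permutations between lists without repetition over a setoid.

module _ {a ℓ} (S : Setoid a ℓ) where

  open Setoid S using () renaming (_≈_ to _≈ₛ_; refl to ≈-refl; sym to ≈-sym; trans to ≈-trans)
  open SetoidMembership S using () renaming (_∈_ to _∈ₛ_)
  open Permutation S
  open UniqueSetoid S using () renaming (Unique to Uniqueₛ)

  -- Induction on `xs`: its head x is found in `ys` and moved to the front. By uniqueness x recurs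
  -- in neither tail, so both inclusions pass to the tails.
  unique∧set⇒↭ : ∀ {xs ys} → Uniqueₛ xs → Uniqueₛ ys →
    (∀ {x} → x ∈ₛ xs → x ∈ₛ ys) → (∀ {y} → y ∈ₛ ys → y ∈ₛ xs) → xs ↭ ys
  unique∧set⇒↭ {[]}     {[]}    _ _ _ _ = ↭-refl
  unique∧set⇒↭ {[]}     {_ ∷ _} _ _ _ ys⊆xs with ys⊆xs (here ≈-refl)
  ... | ()
  unique∧set⇒↭ {x ∷ xs} {ys} xs! ys! xs⊆ys ys⊆xs
    with SetoidMembershipₚ.∈-∃++ S (xs⊆ys (here ≈-refl))
  ... | as , bs , w , x≈w , ys≋ = ↭-trans (↭-prep x rest) (↭-sym ys↭)
    where
    ys↭ : ys ↭ x ∷ as ++ bs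
    ys↭ = ↭-trans (↭-reflexive-≋ ys≋) (Permutationₚ.shift S (≈-sym x≈w) as bs)

    zs! : Uniqueₛ (x ∷ as ++ bs)
    zs! = Permutationₚ.Unique-resp-↭ S ys↭ ys!

    strip : ∀ {us vs z} → Uniqueₛ (x ∷ us) → z ∈ₛ us → z ∈ₛ (x ∷ vs) → z ∈ₛ vs
    strip us! z∈us (here z≈x)   = contradiction
      (SetoidMembershipₚ.∈-resp-≈ S z≈x z∈us) (UniqueSetoidₚ.Unique[x∷xs]⇒x∉xs S us!)
    strip us! z∈us (there z∈vs) = z∈vs

    tail! : ∀ {us} → Uniqueₛ (x ∷ us) → Uniqueₛ us
    tail! (_ ∷ us!) = us!

    rest : xs ↭ as ++ bs
    rest = unique∧set⇒↭ (tail! xs!) (tail! zs!)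
      (λ z∈ → strip xs! z∈ (Permutationₚ.∈-resp-↭ S ys↭ (xs⊆ys (there z∈))))
      (λ z∈ → strip zs! z∈ (ys⊆xs (Permutationₚ.∈-resp-↭ S (↭-sym ys↭) (there z∈))))

  module _ {c} {C : Set c} (f : C → Setoid.Carrier S) where

    InjectiveOn : List C → Set _
    InjectiveOn xs = ∀ {x y} → x ∈ₗ xs → y ∈ₗ xs → f x ≈ₛ f y → x ≡ y

    -- Injectivity up to the equality of S makes both multisets of values repetition-free, so
    -- matching the values in both directions is enough. With S the residues modulo a label, this
    -- produces congruences.
    map-↭ : ∀ {xs ys} → Unique xs → Unique ys → InjectiveOn xs → InjectiveOn ys →
      (∀ {x} → x ∈ₗ xs → ∃[ y ] y ∈ₗ ys × f x ≈ₛ f y) →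
      (∀ {y} → y ∈ₗ ys → ∃[ x ] x ∈ₗ xs × f y ≈ₛ f x) →
      map f xs ↭ map f ys
    map-↭ xs! ys! injˣ injʸ xs→ys ys→xs = unique∧set⇒↭
      (unique-map⁺-∈ S f injˣ xs!) (unique-map⁺-∈ S f injʸ ys!) (image-⊆ xs→ys) (image-⊆ ys→xs)
      where
      image-⊆ : ∀ {us vs} → (∀ {u} → u ∈ₗ us → ∃[ v ] v ∈ₗ vs × f u ≈ₛ f v) →
        ∀ {z} → z ∈ₛ map f us → z ∈ₛ map f vs
      image-⊆ us→vs z∈ with find (Anyₚ.map⁻ z∈)
      ... | u , u∈ , z≈fu with us→vs u∈
      ...   | v , v∈ , fu≈fv = Anyₚ.map⁺ (lose v∈ (≈-trans z≈fu fu≈fv))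

-- Subsets cut out by decidable predicates, and positions in unique lists.

module _ {n p} {P : Pred (Fin n) p} (P? : Decidable P) where

  comprehension : Subset n
  comprehension = tabulate (does ∘ P?)

  ∈-comprehension⁺ : ∀ {x} → P x → x ∈ comprehension
  ∈-comprehension⁺ {x} px =
    lookup⇒[]= x _ (trans (lookup∘tabulate (does ∘ P?) x) (dec-true (P? x) px))

  ∈-comprehension⁻ : ∀ {x} → x ∈ comprehension → P x
  ∈-comprehension⁻ {x} x∈ with P? x | trans (sym (lookup∘tabulate (does ∘ P?) x)) ([]=⇒lookup x∈)
  ... | yes px | _  = px
  ... | no  _  | ()

lookup-injective : ∀ {a} {A : Set a} {xs : List A} → Unique xs → ∀ {i j} →
  lookup xs i ≡ lookup xs j → i ≡ j
lookup-injective (x∉ ∷ _) {zero}  {zero}  _  = refl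
lookup-injective (x∉ ∷ _) {zero}  {suc j} eq = contradiction eq (All.lookup x∉ (∈-lookup j))
lookup-injective (x∉ ∷ _) {suc i} {zero}  eq = contradiction (sym eq) (All.lookup x∉ (∈-lookup i))
lookup-injective (_ ∷ xs!) {suc i} {suc j} eq = cong suc (lookup-injective xs! eq)

-- Incidence, subgraphs and their intersections.

module Incidence (Γ : Graph) where

  open Graph Γ

  -- Unfolds to the condition on endpoints in `Adjacent`, so each step of a path supplies it
  -- directly, and either end of an edge can play the role of p.
  _Joins_and_ : Fin #E → Fin #V → Fin #V → Set
  e Joins p and q = (end₁ e ≡ p × end₂ e ≡ q) ⊎ (end₁ e ≡ q × end₂ e ≡ p)

  joins⇒incident : ∀ {e p q} → e Joins p and q → e IncidentTo p
  joins⇒incident (inj₁ (eq , _)) = inj₁ eq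
  joins⇒incident (inj₂ (_ , eq)) = inj₂ eq

  joins-sym : ∀ {e p q} → e Joins p and q → e Joins q and p
  joins-sym = swap

module _ {Γ : Graph} where

  open Graph Γ
  open Incidence Γ
  open Subgraph

  module _ (Δ : Subgraph Γ) where

    joins⇒∈ : ∀ {e p q} → e ∈ edges Δ → e Joins p and q → p ∈ vertices Δ × q ∈ vertices Δ
    joins⇒∈ e∈ (inj₁ (refl , refl)) = closed Δ e∈
    joins⇒∈ e∈ (inj₂ (refl , refl)) = proj₂ (closed Δ e∈) , proj₁ (closed Δ e∈)

    ∈-edgesAtIn⁺ : ∀ {e p} → e ∈ edges Δ → e IncidentTo p → e ∈ₗ edgesAtIn Δ p
    ∈-edgesAtIn⁺ {e} {p} e∈ inc =
      ∈-filter⁺ (_∈? edges Δ) (∈-filter⁺ (incidentTo? p) (∈-allFin e) inc) e∈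

    ∈-edgesAtIn⁻ : ∀ {e p} → e ∈ₗ edgesAtIn Δ p → e ∈ edges Δ × e IncidentTo p
    ∈-edgesAtIn⁻ {e} {p} e∈ with ∈-filter⁻ (_∈? edges Δ) {xs = edgesAt p} e∈
    ... | e∈p , e∈Δ = e∈Δ , proj₂ (∈-filter⁻ (incidentTo? p) {xs = allFin #E} e∈p)

    edgesAtIn-unique : ∀ p → Unique (edgesAtIn Δ p)
    edgesAtIn-unique p = filter⁺ (_∈? edges Δ) (filter⁺ (incidentTo? p) (allFin⁺ #E))

    edgesAtIn-⊆ : ∀ p → edgesAtIn Δ p ⊆ₗ edgesAt p
    edgesAtIn-⊆ p = Sublistₚ.filter-⊆ (_∈? edges Δ) (edgesAt p)

  ⊑-trans : ∀ {Δ Δ′ Δ″ : Subgraph Γ} → Δ ⊑ Δ′ → Δ′ ⊑ Δ″ → Δ ⊑ Δ″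
  ⊑-trans (v , e) (v′ , e′) = v′ ∘ v , e′ ∘ e

  edgesAtIn-mono : ∀ (Δ Δ′ : Subgraph Γ) → Δ ⊑ Δ′ → ∀ p → edgesAtIn Δ p ⊆ₗ edgesAtIn Δ′ p
  edgesAtIn-mono Δ Δ′ Δ⊑Δ′ p = Sublistₚ.filter⁺ (_∈? edges Δ) (_∈? edges Δ′)
    (λ { refl → proj₂ Δ⊑Δ′ }) (⊆-refl {x = edgesAt p})

  edges-intersection⁺ : ∀ {s} (F : Fin s → Subgraph Γ) {e} →
    (∀ i → e ∈ edges (F i)) → e ∈ edges (intersection F)
  edges-intersection⁺ {zero}  F e∈ = ∈⊤
  edges-intersection⁺ {suc s} F e∈ =
    x∈p∩q⁺ (e∈ zero , edges-intersection⁺ (F ∘ suc) (e∈ ∘ suc))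

  intersection-⊑ : ∀ {s} (F : Fin s → Subgraph Γ) i → intersection F ⊑ F i
  intersection-⊑ F zero    = proj₁ ∘ x∈p∩q⁻ (vertices (F zero)) _
                           , proj₁ ∘ x∈p∩q⁻ (edges (F zero)) _
  intersection-⊑ F (suc i) =
      proj₁ (intersection-⊑ (F ∘ suc) i) ∘ proj₂ ∘ x∈p∩q⁻ (vertices (F zero)) _
    , proj₂ (intersection-⊑ (F ∘ suc) i) ∘ proj₂ ∘ x∈p∩q⁻ (edges (F zero)) _

  -- Connected components of a subgraph.

  module Components (Δ : Subgraph Γ) where

    private
      Connection : Fin #V → Fin #V → Set
      Connection = Star (Adjacent Δ)

      connection-sym : ∀ {p q} → Connection p q → Connection q p
      connection-sym = reverse λ (e , e∈ , joins) → e , e∈ , joins-sym joins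

      -- Starting from the identity, the edges are contracted one after another.
      contract : (es : List (Fin #E)) → (∀ {e} → e ∈ₗ es → e ∈ edges Δ) →
        ∃[ r ] (∀ p → Connection p (r p)) × (∀ {e} → e ∈ₗ es → r (end₁ e) ≡ r (end₂ e))
      contract []       es⊆Δ = (λ p → p) , (λ _ → ε) , λ ()
      contract (e ∷ es) es⊆Δ with contract es (es⊆Δ ∘ there)
      ... | r , connects , identifies =
        merge ∘ r , (λ p → connects p ◅◅ merge-connects (r p)) , merge-identifies
        where
        a = r (end₁ e)
        b = r (end₂ e)

        merge : Fin #V → Fin #V
        merge q = if does (q Fin.≟ b) then a else q

        merge-connects : ∀ q → Connection q (merge q)
        merge-connects q with q Fin.≟ b
        ... | no  _    = ε
        -- Here q is `r (end₂ e)`: go back from it to `end₂ e`, cross e, and follow the earlier path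
        -- from `end₁ e` to a.
        ... | yes refl = connection-sym (connects (end₂ e))
          ◅◅ (e , es⊆Δ (here refl) , inj₂ (refl , refl)) ◅ connects (end₁ e)

        merge-a : merge a ≡ a
        merge-a with a Fin.≟ b
        ... | yes _ = refl
        ... | no  _ = refl

        merge-b : merge b ≡ a
        merge-b with b Fin.≟ b
        ... | yes _   = refl
        ... | no  b≢b = contradiction refl b≢b

        merge-identifies : ∀ {f} → f ∈ₗ (e ∷ es) → merge (r (end₁ f)) ≡ merge (r (end₂ f))
        merge-identifies (here refl) = trans merge-a (sym merge-b)
        merge-identifies (there f∈)  = cong merge (identifies f∈)

      contraction = contract (filter (_∈? edges Δ) (allFin #E))
        (λ e∈ → proj₂ (∈-filter⁻ (_∈? edges Δ) {xs = allFin #E} e∈))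

    -- A chosen vertex in the component of each vertex. Two vertices are connected in Δ exactly when
    -- their representatives agree, which turns connectedness into a decidable equality.
    representative : Fin #V → Fin #V
    representative = proj₁ contraction

    connected-to-representative : ∀ p → Star (Adjacent Δ) p (representative p)
    connected-to-representative = proj₁ (proj₂ contraction)

    representative-ends : ∀ {e} → e ∈ edges Δ → representative (end₁ e) ≡ representative (end₂ e)
    representative-ends {e} e∈ =
      proj₂ (proj₂ contraction) (∈-filter⁺ (_∈? edges Δ) (∈-allFin e) e∈)

    representative-joins : ∀ {e p q} → e ∈ edges Δ → e Joins p and q →
      representative p ≡ representative q
    representative-joins e∈ (inj₁ (refl , refl)) = representative-ends e∈
    representative-joins e∈ (inj₂ (refl , refl)) = sym (representative-ends e∈)

    representative-connection : ∀ {p q} → Star (Adjacent Δ) p q →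
      representative p ≡ representative q
    representative-connection ε                       = refl
    representative-connection ((_ , e∈ , joins) ◅ pq) =
      trans (representative-joins e∈ joins) (representative-connection pq)

    -- An edge of Δ has both ends in Δ, so a path that starts in Δ never leaves it. This has to be
    -- shown because `representative` is defined on all vertices of Γ.
    representative-∈ : ∀ {p} → p ∈ vertices Δ → representative p ∈ vertices Δ
    representative-∈ p∈ = stays p∈ (connected-to-representative _)
      where
      stays : ∀ {p q} → p ∈ vertices Δ → Star (Adjacent Δ) p q → q ∈ vertices Δ
      stays p∈ ε                      = p∈
      stays p∈ ((_ , e∈ , joins) ◅ pq) = stays (proj₂ (joins⇒∈ Δ e∈ joins)) pq

    connection : ∀ {p q} → representative p ≡ representative q → Star (Adjacent Δ) p q
    connection {p} {q} eq = connected-to-representative p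
      ◅◅ subst (λ r → Star (Adjacent Δ) r q) (sym eq)
           (connection-sym (connected-to-representative q))

    InClass : Fin #V → Fin #V → Set
    InClass r p = p ∈ vertices Δ × representative p ≡ r

    inClass? : ∀ r → Decidable (InClass r)
    inClass? r p = (p ∈? vertices Δ) ×-dec (representative p Fin.≟ r)

    -- Testing `end₁` suffices, since by `representative-ends` the other end of an edge of Δ has the
    -- same representative.
    EdgeInClass : Fin #V → Fin #E → Set
    EdgeInClass r e = e ∈ edges Δ × representative (end₁ e) ≡ r

    edgeInClass? : ∀ r → Decidable (EdgeInClass r)
    edgeInClass? r e = (e ∈? edges Δ) ×-dec (representative (end₁ e) Fin.≟ r)

    component : Fin #V → Subgraph Γ
    vertices (component r) = comprehension (inClass? r)
    edges    (component r) = comprehension (edgeInClass? r)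
    closed   (component r) e∈ with ∈-comprehension⁻ (edgeInClass? r) e∈
    ... | e∈Δ , eq =
        ∈-comprehension⁺ (inClass? r) (proj₁ (closed Δ e∈Δ) , eq)
      , ∈-comprehension⁺ (inClass? r)
          (proj₂ (closed Δ e∈Δ) , trans (sym (representative-ends e∈Δ)) eq)

    ∈-component⁺ : ∀ {r p} → p ∈ vertices Δ → representative p ≡ r → p ∈ vertices (component r)
    ∈-component⁺ {r} p∈ eq = ∈-comprehension⁺ (inClass? r) (p∈ , eq)

    ∈-component⁻ : ∀ {r p} → p ∈ vertices (component r) → p ∈ vertices Δ × representative p ≡ r
    ∈-component⁻ {r} = ∈-comprehension⁻ (inClass? r)

    component-edge⁺ : ∀ {r p e} → p ∈ vertices (component r) → e ∈ edges Δ → e IncidentTo p →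
      e ∈ edges (component r)
    component-edge⁺ {r} {p} {e} p∈ e∈ inc = ∈-comprehension⁺ (edgeInClass? r)
      (e∈ , trans (start inc) (proj₂ (∈-component⁻ p∈)))
      where
      start : e IncidentTo p → representative (end₁ e) ≡ representative p
      start (inj₁ refl) = refl
      start (inj₂ refl) = representative-ends e∈

    component-edge⁻ : ∀ {r e} → e ∈ edges (component r) →
      e ∈ edges Δ × representative (end₁ e) ≡ r
    component-edge⁻ {r} = ∈-comprehension⁻ (edgeInClass? r)

    component-edgesAtIn : ∀ {r p} → p ∈ vertices (component r) →
      edgesAtIn (component r) p ≡ edgesAtIn Δ p
    component-edgesAtIn {r} {p} p∈ =
      filter-cong-∈ (_∈? edges (component r)) (_∈? edges Δ) (edgesAt p)
      (λ _ → proj₁ ∘ component-edge⁻)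
      (λ e∈p e∈Δ → component-edge⁺ p∈ e∈Δ (proj₂ (∈-filter⁻ (incidentTo? p) {xs = allFin #E} e∈p)))

    -- A component keeps every edge of Δ at its vertices, so a path of Δ that starts in it stays in
    -- it. That r represents itself makes the component nonempty.
    component-connected : ∀ {r} → InClass r r → Connected (component r)
    component-connected {r} (r∈ , eq) = (r , ∈-component⁺ r∈ eq) , λ q∈ q′∈ →
      lift q∈ (connection (trans (proj₂ (∈-component⁻ q∈)) (sym (proj₂ (∈-component⁻ q′∈)))))
      where
      lift : ∀ {q q′} → q ∈ vertices (component r) → Star (Adjacent Δ) q q′ →
        Star (Adjacent (component r)) q q′
      lift q∈ ε                         = ε
      lift q∈ ((e , e∈ , joins) ◅ path) =
        (e , e∈C , joins) ◅ lift (proj₂ (joins⇒∈ (component r) e∈C joins)) path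
        where
        e∈C : e ∈ edges (component r)
        e∈C = component-edge⁺ q∈ e∈ (joins⇒incident joins)

    -- Each component has exactly one vertex that represents itself, so these vertices index the
    -- components without repetition.
    representatives : List (Fin #V)
    representatives = filter (λ r → inClass? r r) (allFin #V)

    components : Fin (length representatives) → Subgraph Γ
    components j = component (lookup representatives j)

    lookup-representative : ∀ j → InClass (lookup representatives j) (lookup representatives j)
    lookup-representative j =
      proj₂ (∈-filter⁻ (λ r → inClass? r r) {xs = allFin #V} (∈-lookup j))

    class-index : ∀ {p} → p ∈ vertices Δ → ∃[ j ] representative p ≡ lookup representatives j
    class-index {p} p∈ = index r∈ , Anyₚ.lookup-index r∈
      where
      r∈ : representative p ∈ₗ representatives
      r∈ = ∈-filter⁺ (λ r → inClass? r r) (∈-allFin (representative p))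
        -- `representative` is idempotent, being constant along the path from p to its
        -- representative.
        (representative-∈ p∈ , sym (representative-connection (connected-to-representative p)))

    components-disjointUnion : IsDisjointUnion Δ components
    components-disjointUnion = record
      { vertices-union = λ p → mk⇔
          (λ p∈ → proj₁ (class-index p∈) , ∈-component⁺ p∈ (proj₂ (class-index p∈)))
          (λ (j , p∈) → proj₁ (∈-component⁻ p∈))
      ; edges-union = λ e → mk⇔
          (λ e∈ → let (j , eq) = class-index (proj₁ (closed Δ e∈))
                  in j , ∈-comprehension⁺ (edgeInClass? _) (e∈ , eq))
          (λ (j , e∈) → proj₁ (component-edge⁻ e∈))
      ; disjoint = λ {i} {j} i≢j (p , p∈) →
          let p∈i , p∈j = x∈p∩q⁻ (vertices (components i)) (vertices (components j)) p∈
          in i≢j (lookup-injective (filter⁺ (λ r → inClass? r r) (allFin⁺ #V))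
               (trans (sym (proj₂ (∈-component⁻ p∈i))) (proj₂ (∈-component⁻ p∈j))))
      }

-- Subgraphs satisfying the congruence along each of their edges.

infix 4 _≈[_]_

_≈[_]_ : ∀ {k} → Hom k → Hom k → Hom k → Set
ρ ≈[ τ ] σ = Setoid._≈_ (modulo τ) ρ σ

module _ {k n : ℕ} (S : AbstractOneSkeleton k n) where

  open AbstractOneSkeleton S renaming (regular to Γ-regular)
  open Incidence Γ
  open Subgraph
  open GroupHomomorphism using (⟦_⟧)

  module CongruentSubgraph (Δ : Subgraph Γ)
    (congruentΔ : ∀ e → e ∈ edges Δ →
      map α (edgesAtIn Δ (end₁ e)) ≡ map α (edgesAtIn Δ (end₂ e)) mod α e) where

    open Components Δ

    valence : Fin #V → ℕ
    valence p = length (edgesAtIn Δ p)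

    congruent-joins : ∀ {e p q} → e ∈ edges Δ → e Joins p and q →
      map α (edgesAtIn Δ p) ≡ map α (edgesAtIn Δ q) mod α e
    congruent-joins {e} e∈ (inj₁ (refl , refl)) = congruentΔ e e∈
    congruent-joins {e} e∈ (inj₂ (refl , refl)) = Permutation.↭-sym (modulo (α e)) (congruentΔ e e∈)

    -- A permutation preserves membership up to equality of residues, so every edge at p has a
    -- counterpart at q modulo the label of e.
    transport : ∀ {e p q f} → e ∈ edges Δ → e Joins p and q → f ∈ₗ edgesAtIn Δ p →
      ∃[ g ] g ∈ₗ edgesAtIn Δ q × α f ≈[ α e ] α g
    transport {e} {p} {q} {f} e∈ joins f∈ = find (Anyₚ.map⁻
      (Permutationₚ.∈-resp-↭ (modulo (α e)) {x = α f} (congruent-joins e∈ joins)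
        (Anyₚ.map⁺ (lose f∈ (Setoid.refl (modulo (α e)) {α f})))))

    valence-joins : ∀ {e p q} → e ∈ edges Δ → e Joins p and q → valence p ≡ valence q
    valence-joins {e} {p} {q} e∈ joins = trans (sym (length-map α (edgesAtIn Δ p)))
      (trans (Permutationₚ.xs↭ys⇒|xs|≡|ys| (modulo (α e)) (congruent-joins e∈ joins))
             (length-map α (edgesAtIn Δ q)))

    valence-connection : ∀ {p q} → Star (Adjacent Δ) p q → valence p ≡ valence q
    valence-connection ε                       = refl
    valence-connection ((_ , e∈ , joins) ◅ pq) =
      trans (valence-joins e∈ joins) (valence-connection pq)

    -- The counterpart g of f at q satisfies α f = α g + c α e for some scalar c, and e is itself an
    -- edge at q. Thus both terms lie in the span at q.
    span-joins : ∀ {e p q} → e ∈ edges Δ → e Joins p and q → ∀ {ρ} →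
      InSpan (map α (edgesAtIn Δ p)) ρ → InSpan (map α (edgesAtIn Δ q)) ρ
    span-joins {e} {p} {q} e∈ joins {ρ} = span-least K generator {ρ}
      where
      K : Subspace
      K = span (map α (edgesAtIn Δ q))

      open Subspace K

      member : ∀ {f} → f ∈ₗ edgesAtIn Δ q → Member (α f)
      member f∈ = ∈⇒InSpan (∈-map⁺ α f∈)

      generator : ∀ {σ} → σ ∈ₗ map α (edgesAtIn Δ p) → Member σ
      generator σ∈ with ∈-map⁻ α σ∈
      ... | f , f∈ , refl with transport e∈ joins f∈
      ...   | g , g∈ , c , f≈g = resp {α g + c • α e} {α f} (λ x → sym (f≈g x))
        (+-mem {α g} {c • α e} (member g∈)
          (•-mem c {α e} (member (∈-edgesAtIn⁺ Δ e∈ (joins⇒incident (joins-sym joins))))))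

    span-connection : ∀ {p q} → Star (Adjacent Δ) p q → ∀ {ρ} →
      InSpan (map α (edgesAtIn Δ p)) ρ → InSpan (map α (edgesAtIn Δ q)) ρ
    span-connection ε                       ρ∈     = ρ∈
    span-connection ((_ , e∈ , joins) ◅ pq) {ρ} ρ∈ =
      span-connection pq {ρ} (span-joins e∈ joins {ρ} ρ∈)

    -- Valence and span at r are carried to every vertex of the component along paths of Δ, and its
    -- edges at each vertex are those of Δ, so the congruences are inherited.
    component-isFace : ∀ {r} → InClass r r → IsFace S (valence r) (component r)
    component-isFace {r} r∈@(_ , eq) = record
      { dim≤n     = subst (valence r ≤_) (Γ-regular r) (Sublistₚ.length-mono-≤ (edgesAtIn-⊆ Δ r))
      ; connected = component-connected r∈
      ; regular   = λ p p∈ →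
          trans (cong length (component-edgesAtIn p∈)) (valence-connection (to-root p∈))
      ; K         = span (map α (edgesAtIn Δ r))
      ; spanning  = λ p p∈ ρ → subst
          (λ es → map α es Spans span (map α (edgesAtIn Δ r))) (sym (component-edgesAtIn p∈))
          (λ σ → mk⇔ (span-connection (to-root p∈) {σ}) (span-connection (from-root p∈) {σ})) ρ
      ; congruent = λ e e∈ → subst₂ (λ es fs → map α es ≡ map α fs mod α e)
          (sym (component-edgesAtIn (proj₁ (closed (component r) e∈))))
          (sym (component-edgesAtIn (proj₂ (closed (component r) e∈))))
          (congruentΔ e (proj₁ (component-edge⁻ e∈)))
      }
      where
      to-root : ∀ {p} → p ∈ vertices (component r) → Star (Adjacent Δ) p r
      to-root p∈ = connection (trans (proj₂ (∈-component⁻ p∈)) (sym eq))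

      from-root : ∀ {p} → p ∈ vertices (component r) → Star (Adjacent Δ) r p
      from-root p∈ = connection (trans eq (sym (proj₂ (∈-component⁻ p∈))))

  -- Separation of residues in faces of dimension below l.

  module _ {l : ℕ} (independent : Independent S l) (l≤n : l ≤ n) where

    -- The edge g may lie outside F, which makes it possible to compare edges that come from two
    -- different faces. The edges of F at p and g are completed to l independent ones, where
    -- `separates-residues` applies.
    face-separates : ∀ {d F} → IsFace S d F → d < l → ∀ {p e f g} → p ∈ vertices F →
      e ∈ₗ edgesAtIn F p → f ∈ₗ edgesAtIn F p → g ∈ₗ edgesAt p →
      α f ≈[ α e ] α g → f ≡ g
    face-separates {d} {F} face d<l {p} {e} {f} {g} p∈ e∈ f∈ g∈ (c , f≈g)
      with insert-sublist (edgesAtIn-⊆ F p) g∈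
    ... | es , F⊆es , es⊆p , g∈es , |es|≤
      with pad-sublist es⊆p
        -- The strict inequality d < l leaves room for one edge besides the d edges of the face.
        (≤-trans |es|≤ (subst (λ v → suc v ≤ l) (sym (IsFace.regular face p p∈)) d<l))
        (subst (l ≤_) (sym (Γ-regular p)) l≤n)
    ... | fs , es⊆fs , fs⊆p , |fs|≡l =
      index-map⁺-injective α f∈fs g∈fs (separates-residues
        {ρs = map α fs} (independent p fs fs⊆p |fs|≡l) {h = index (∈-map⁺ α e∈fs)} c
        λ x → trans (cong (λ ρ → ⟦ ρ ⟧ x) (sym (label f∈fs)))
          (trans (f≈g x) (cong₂ (λ σ τ → ⟦ σ + c • τ ⟧ x) (label g∈fs) (label e∈fs))))
      where
      f∈fs : f ∈ₗ fs
      f∈fs = Sublist.lookup es⊆fs (Sublist.lookup F⊆es f∈)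
      g∈fs : g ∈ₗ fs
      g∈fs = Sublist.lookup es⊆fs g∈es
      e∈fs : e ∈ₗ fs
      e∈fs = Sublist.lookup es⊆fs (Sublist.lookup F⊆es e∈)

      label : ∀ {h} (h∈ : h ∈ₗ fs) → α h ≡ lookup (map α fs) (index (∈-map⁺ α h∈))
      label h∈ = Anyₚ.lookup-index (∈-map⁺ α h∈)

    -- The intersection of a family of faces.

    module Intersection {s} {m : Fin s → ℕ} {F : Fin s → Subgraph Γ}
      (faces : ∀ i → IsFace S (m i) (F i)) (m<l : ∀ i → m i < l) (i₀ : Fin s) where

      Δ : Subgraph Γ
      Δ = intersection F

      private
        module Face i = CongruentSubgraph (F i) (IsFace.congruent (faces i))

      Δ⊑F : ∀ i → Δ ⊑ F i
      Δ⊑F = intersection-⊑ F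

      common-edge : ∀ {p f} i → f ∈ₗ edgesAtIn Δ p → f ∈ₗ edgesAtIn (F i) p
      common-edge i = Sublist.lookup (edgesAtIn-mono Δ (F i) (Δ⊑F i) _)

      -- Each face gives its own counterpart `g i` of f at q. All of them are congruent to f modulo
      -- α e, hence to one another, and separation in `F i` identifies `g i` with `g i₀`. So `g i₀`
      -- lies in every face.
      common-transport : ∀ {e p q f} → e ∈ edges Δ → e Joins p and q → f ∈ₗ edgesAtIn Δ p →
        ∃[ g ] g ∈ₗ edgesAtIn Δ q × α f ≈[ α e ] α g
      common-transport {e} {p} {q} {f} e∈ joins f∈ =
        g i₀
        , ∈-edgesAtIn⁺ Δ (edges-intersection⁺ F g∈) (proj₂ (∈-edgesAtIn⁻ (F i₀) (g∈Fq i₀)))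
        , f≈g i₀
        where
        image : ∀ i → ∃[ g ] g ∈ₗ edgesAtIn (F i) q × α f ≈[ α e ] α g
        image i = Face.transport i (proj₂ (Δ⊑F i) e∈) joins (common-edge i f∈)

        g : Fin s → Fin #E
        g i = proj₁ (image i)

        g∈Fq : ∀ i → g i ∈ₗ edgesAtIn (F i) q
        g∈Fq i = proj₁ (proj₂ (image i))

        f≈g : ∀ i → α f ≈[ α e ] α (g i)
        f≈g i = proj₂ (proj₂ (image i))

        e∈Δq : e ∈ₗ edgesAtIn Δ q
        e∈Δq = ∈-edgesAtIn⁺ Δ e∈ (joins⇒incident (joins-sym joins))

        open Setoid (modulo (α e)) using () renaming (sym to ≈-sym; trans to ≈-trans)

        g≡g₀ : ∀ i → g i ≡ g i₀
        g≡g₀ i = face-separates (faces i) (m<l i)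
          (proj₂ (joins⇒∈ (F i) (proj₂ (Δ⊑F i) e∈) joins))
          (common-edge i e∈Δq) (g∈Fq i)
          (Sublist.lookup (edgesAtIn-⊆ (F i₀) q) (g∈Fq i₀))
          (≈-trans {α (g i)} {α f} {α (g i₀)} (≈-sym {α f} {α (g i)} (f≈g i)) (f≈g i₀))

        g∈ : ∀ i → g i₀ ∈ edges (F i)
        g∈ i = subst (_∈ edges (F i)) (g≡g₀ i) (proj₁ (∈-edgesAtIn⁻ (F i) (g∈Fq i)))

      -- Separation in `F i₀` makes the residues at each end pairwise distinct, so it suffices to
      -- transport edges across e in both directions.
      common-congruent : ∀ e → e ∈ edges Δ →
        map α (edgesAtIn Δ (end₁ e)) ≡ map α (edgesAtIn Δ (end₂ e)) mod α e
      common-congruent e e∈ = map-↭ (modulo (α e)) α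
        (edgesAtIn-unique Δ (end₁ e)) (edgesAtIn-unique Δ (end₂ e))
        (injective (proj₁ (closed Δ e∈)) (∈-edgesAtIn⁺ Δ e∈ (inj₁ refl)))
        (injective (proj₂ (closed Δ e∈)) (∈-edgesAtIn⁺ Δ e∈ (inj₂ refl)))
        (common-transport e∈ (inj₁ (refl , refl)))
        (common-transport e∈ (inj₂ (refl , refl)))
        where
        injective : ∀ {p} → p ∈ vertices Δ → e ∈ₗ edgesAtIn Δ p →
          InjectiveOn (modulo (α e)) α (edgesAtIn Δ p)
        injective {p} p∈ e∈p f∈ g∈ = face-separates (faces i₀) (m<l i₀) (proj₁ (Δ⊑F i₀) p∈)
          (common-edge i₀ e∈p) (common-edge i₀ f∈) (Sublist.lookup (edgesAtIn-⊆ Δ p) g∈)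

      open Components Δ public
      open CongruentSubgraph Δ common-congruent public

      valence≤ : ∀ {p} → p ∈ vertices Δ → ∀ i → valence p ≤ m i
      valence≤ {p} p∈ i = subst (valence p ≤_) (IsFace.regular (faces i) p (proj₁ (Δ⊑F i) p∈))
        (Sublistₚ.length-mono-≤ (edgesAtIn-mono Δ (F i) (Δ⊑F i) p))

      module FullValence {i r} (r∈ : r ∈ vertices Δ) (full : valence r ≡ m i) where

        full-edge : ∀ {p e} → p ∈ vertices Δ → valence p ≡ m i →
          e ∈ edges (F i) → e IncidentTo p → e ∈ edges Δ
        full-edge {p} {e} p∈ fullₚ e∈ inc = proj₁ (∈-edgesAtIn⁻ Δ
          (subst (e ∈ₗ_) (sym same) (∈-edgesAtIn⁺ (F i) e∈ inc)))
          where
          same : edgesAtIn Δ p ≡ edgesAtIn (F i) p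
          -- A sublist of full length is the whole list.
          same = Pointwise-≡⇒≡ (Sublistₚ.to-≋
            (trans fullₚ (sym (IsFace.regular (faces i) p (proj₁ (Δ⊑F i) p∈))))
            (edgesAtIn-mono Δ (F i) (Δ⊑F i) p))

        -- At a vertex of full valence every edge of `F i` belongs to Δ. The next step of the path
        -- is therefore taken in Δ, along which the valence is constant, and the argument repeats.
        spread : ∀ {p q} → p ∈ vertices Δ → valence p ≡ m i → Star (Adjacent (F i)) p q →
          q ∈ vertices Δ × valence q ≡ m i
        spread p∈ fullₚ ε                        = p∈ , fullₚ
        spread p∈ fullₚ ((e , e∈ , joins) ◅ path) =
          spread (proj₂ (joins⇒∈ Δ e∈Δ joins)) (trans (sym (valence-joins e∈Δ joins)) fullₚ) path
          where
          e∈Δ : e ∈ edges Δ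
          e∈Δ = full-edge p∈ fullₚ e∈ (joins⇒incident joins)

        everywhere : ∀ {q} → q ∈ vertices (F i) → q ∈ vertices Δ × valence q ≡ m i
        everywhere q∈ =
          spread r∈ full (proj₂ (IsFace.connected (faces i)) (proj₁ (Δ⊑F i) r∈) q∈)

        F⊑Δ : F i ⊑ Δ
        F⊑Δ = proj₁ ∘ everywhere , λ e∈ →
          let (p∈ , fullₚ) = everywhere (proj₁ (closed (F i) e∈))
          in full-edge p∈ fullₚ e∈ (inj₁ refl)

      -- If the valence equals `m i`, then `F i` lies in Δ and hence in every `F j`, which is the
      -- excluded case.
      lowerDimension : ∀ {r} → r ∈ vertices Δ → LowerDimension S m F (valence r)
      lowerDimension {r} r∈ i = valence≤ r∈ i , λ F⋢ →
        [ id , full⇒ F⋢ ]′ (m≤n⇒m<n∨m≡n (valence≤ r∈ i))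
        where
        full⇒ : ¬ (∀ j → F i ⊑ F j) → valence r ≡ m i → valence r < m i
        full⇒ F⋢ full = contradiction
          (λ j → ⊑-trans {Δ = F i} {Δ} {F j} (FullValence.F⊑Δ r∈ full) (Δ⊑F j)) F⋢

      disjointUnionOfLowerFaces : IsDisjointUnionOfLowerFaces S m F Δ
      disjointUnionOfLowerFaces =
        length representatives , valence ∘ lookup representatives , components ,
        components-disjointUnion ,
        λ j → component-isFace (lookup-representative j)
            , lowerDimension (proj₁ (lookup-representative j))

proposition3p2 : (k n l : ℕ) → 1 ≤ k → k ≤ n → l ≤ k →
    (S : AbstractOneSkeleton k n) → Independent S l →
    (s : ℕ) → 1 < s →
    (m : Fin s → ℕ) (F : Fin s → Subgraph (AbstractOneSkeleton.Γ S)) →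
    (∀ i → IsFace S (m i) (F i)) → (∀ i → m i < l) →
    IsEmpty (intersection F) ⊎ IsDisjointUnionOfLowerFaces S m F (intersection F)
proposition3p2 k n l 1≤k k≤n l≤k S independent (suc s) 1<s m F faces m<l =
  -- An empty intersection is obtained here as the union of no components. The face at `zero` serves
  -- as `i₀`.
  inj₂ (Intersection.disjointUnionOfLowerFaces S independent (≤-trans l≤k k≤n) faces m<l zero)
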